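{- Let $m\ge 1$ and let $(S^1,S^2,\ldots,S^m)$ be a position of Star Silver Dollar, where $S^i=[a^i_1,\ldots,a^i_{k_i}]$ with $k_i\ge 1$. For each $i$ set $S^i_H=[a^i_1]$ and $S^i_T=[a^i_2,\ldots,a^i_{k_i}]$ if $k_i$ is odd, and $S^i_H=[a^i_1,a^i_2]$ and $S^i_T=[a^i_3,\ldots,a^i_{k_i}]$ if $k_i$ is even (so $S^i_T$ may be empty). Then $$\mathcal{G}(S^1,S^2,\ldots,S^m)=\mathcal{G}(S^1_H,S^2_H,\ldots,S^m_H)\oplus\mathcal{G}(S^1_T)\oplus\mathcal{G}(S^2_T)\oplus\cdots\oplus\mathcal{G}(S^m_T),$$ where $\mathcal{G}(S^1,\ldots,S^m)$ and $\mathcal{G}(S^1_H,\ldots,S^m_H)$ are Sprague-Grundy values of Star Silver Dollar positions and each $\mathcal{G}(S^i_T)$ is the Sprague-Grundy value of a (separate, single-strip) Silver Dollar position. That is, as far as Sprague-Grundy values are concerned, the game $(S^1,\ldots,S^m)$ is the disjunctive sum of the Star Silver Dollar game $(S^1_H,\ldots,S^m_H)$ and the Silver Dollar games $S^1_T,\ldots,S^m_T$.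
   Context: Silver Dollar: a position $[a_1,\ldots,a_k]$ is a strictly increasing finite sequence of nonnegative integers (the squares occupied by tokens on a strip with squares $0,1,2,\ldots$). A move replaces some $a_j$ by an integer $c$ with $a_{j-1}<c<a_j$ (with $0\le c<a_1$ if $j=1$): a token moves to a smaller empty square without jumping over another token. The empty position has no moves. Star Silver Dollar with $m$ strips: the squares $0$ of $m$ strips are identified into a single shared square. A position $(S^1,\ldots,S^m)$ consists of $m$ Silver Dollar positions $S^i=[a^i_1,\ldots,a^i_{k_i}]$ such that at most one of the $S^i$ has a token on square $0$ (each square, including the shared square $0$, holds at most one token). A move is a Silver Dollar move in one of the strips whose result is again a legal position (so a token may move to square $0$ only if square $0$ is unoccupied). Both games are impartial games; a player unable to move loses. $\mathcal{G}$ is the Sprague-Grundy value: $\mathcal{G}(p)=\operatorname{mex}\{\mathcal{G}(q): q \text{ reachable from } p \text{ in one move}\}$, where $\operatorname{mex}(S)$ is the least nonnegative integer not in $S$. $\oplus$ is Nim-sum (bitwise addition mod 2 of binary representations). -}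

module Defs where

open import Data.Digit using (Digit; Expansion; toDigits; fromDigits)
open import Data.Fin.Base as Fin using (Fin; zero; suc; toℕ)
import Data.Fin.Properties as Fin
open import Data.List.Base as List
  using (List; []; _∷_; _++_; length; take; drop; upTo; filter; concatMap; allFin)
open import Data.List.Extrema.Nat using (max; xs≤max)
open import Data.List.Membership.Propositional using (_∈_; _∉_; mapWith∈; lose; find)
open import Data.List.Membership.Propositional.Properties
open import Data.List.Membership.DecPropositional using (_∈?_)
open import Data.List.Relation.Unary.All as All using (All)
open import Data.List.Relation.Unary.Linked using (Linked; linked?; [-]; _∷_)
open import Data.Nat.Base
open import Data.Nat.DivMod using (_mod_)
open import Data.Nat.ListAction using (sum)
open import Data.Nat.Induction using (<-wellFounded)
open import Data.Nat.Properties hiding (_≟_)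
import Data.Nat.Properties as ℕ
open import Data.Parity.Base using (0ℙ; 1ℙ)
open import Data.Product.Base using (Σ; ∃; _×_; _,_; proj₁; proj₂)
open import Data.Sum.Base using (inj₁; inj₂)
open import Data.Vec.Base as Vec using (Vec; []; _∷_; lookup; _[_]≔_)
open import Function.Base using (_∘_; flip)
open import Induction.WellFounded using (WellFounded; Acc; acc; module Subrelation)
open import Relation.Binary.Construct.On as On using ()
open import Relation.Binary.PropositionalEquality
open import Relation.Nullary
open import Relation.Nullary.Decidable using (_×-dec_; _→-dec_)
open import Relation.Unary using (Pred; Decidable)

IsMex : Pred ℕ _ → ℕ → Set
IsMex P n = ¬ P n × (∀ {k} → k < n → P k)

mexFrom : ∀ fuel n (xs : List ℕ) →
          (∀ {k} → k < n → k ∈ xs) → (∀ {x} → x ∈ xs → x < n + fuel) →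
          ∃ (IsMex (_∈ xs))
mexFrom zero n xs below bound =
  n , (λ n∈ → <-irrefl (sym (+-identityʳ n)) (bound n∈)) , below
mexFrom (suc fuel) n xs below bound with _∈?_ ℕ._≟_ n xs
... | no  n∉ = n , n∉ , below
... | yes n∈ = mexFrom fuel (suc n) xs below′
                 (λ {x} x∈ → subst (x <_) (+-suc n fuel) (bound x∈))
  where
  below′ : ∀ {k} → k < suc n → k ∈ xs
  below′ {k} k<1+n with m<1+n⇒m<n∨m≡n k<1+n
  ... | inj₁ k<n  = below k<n
  ... | inj₂ refl = n∈

mex-exists : (xs : List ℕ) → ∃ (IsMex (_∈ xs))
mex-exists xs = mexFrom (suc (max 0 xs)) 0 xs (λ ())
                  (λ x∈ → s≤s (All.lookup (xs≤max 0 xs) x∈))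

mex : List ℕ → ℕ
mex xs = proj₁ (mex-exists xs)

mex-isMex : ∀ xs → IsMex (_∈ xs) (mex xs)
mex-isMex xs = proj₂ (mex-exists xs)

record Game : Set₁ where
  infix 4 _⟶_
  field
    Position    : Set
    _⟶_         : Position → Position → Set
    wellFounded : WellFounded (flip _⟶_)
    options     : Position → List Position
    sound       : ∀ {p q} → q ∈ options p → p ⟶ q
    complete    : ∀ {p q} → p ⟶ q → q ∈ options p

module _ (G : Game) where
  open Game G

  grundyAcc : ∀ p → Acc (flip _⟶_) p → ℕ
  grundyAcc p (acc rs) =
    mex (mapWith∈ (options p) (λ {q} q∈ → grundyAcc q (rs (sound q∈))))

  𝒢 : Position → ℕ
  𝒢 p = grundyAcc p (wellFounded p)

  grundyAcc-irrelevant : ∀ p (a b : Acc (flip _⟶_) p) → grundyAcc p a ≡ grundyAcc p b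
  grundyAcc-irrelevant p (acc rs) (acc rs′) = cong mex
    (mapWith∈-cong (options p) _ _
      (λ {q} q∈ → grundyAcc-irrelevant q (rs (sound q∈)) (rs′ (sound q∈))))

  𝒢-unfold : ∀ p → 𝒢 p ≡ mex (List.map 𝒢 (options p))
  𝒢-unfold p with wellFounded p
  ... | acc rs = cong mex (trans
    (mapWith∈-cong (options p) _ _
      (λ {q} q∈ → grundyAcc-irrelevant q (rs (sound q∈)) (wellFounded q)))
    (mapWith∈≗map 𝒢 (options p)))

  𝒢-isMex : ∀ p → IsMex (λ v → ∃ λ q → p ⟶ q × 𝒢 q ≡ v) (𝒢 p)
  𝒢-isMex p rewrite 𝒢-unfold p with mex-isMex (List.map 𝒢 (options p))
  ... | absent , present =
    (λ (q , p⟶q , eq) → absent (subst (_∈ _) eq (∈-map⁺ 𝒢 (complete p⟶q)))) ,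
    (λ k< → let q , q∈ , eq = ∈-map⁻ 𝒢 (present k<) in q , sound q∈ , sym eq)

-- The games below are played on arbitrary lists of squares. Only strictly
-- increasing lists are Silver Dollar positions, and moves preserve this
-- (step-increasing).
Increasing : List ℕ → Set
Increasing = Linked _<_

-- In Step l the squares below l are unavailable; past a token on square a
-- the first available square is suc a.
data Step (l : ℕ) : List ℕ → List ℕ → Set where
  here  : ∀ {a c as} → l ≤ c → c < a → Step l (a ∷ as) (c ∷ as)
  there : ∀ {a as bs} → Step (suc a) as bs → Step l (a ∷ as) (a ∷ bs)

SDMove : List ℕ → List ℕ → Set
SDMove = Step 0

stepOptions : ℕ → List ℕ → List (List ℕ)
stepOptions l []       = []
stepOptions l (a ∷ as) =
  List.map (_∷ as) (filter (l ≤?_) (upTo a)) ++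
  List.map (a ∷_) (stepOptions (suc a) as)

step-sound : ∀ l as {bs} → bs ∈ stepOptions l as → Step l as bs
step-sound l (a ∷ as) bs∈
  with ∈-++⁻ (List.map (_∷ as) (filter (l ≤?_) (upTo a))) bs∈
... | inj₁ p with c , c∈ , refl ← ∈-map⁻ (_∷ as) p
             with c∈upTo , l≤c ← ∈-filter⁻ (l ≤?_) {xs = upTo a} c∈ =
  here l≤c (∈-upTo⁻ c∈upTo)
... | inj₂ p with cs , cs∈ , refl ← ∈-map⁻ (a ∷_) p =
  there (step-sound (suc a) as cs∈)

step-complete : ∀ {l as bs} → Step l as bs → bs ∈ stepOptions l as
step-complete {l} {a ∷ as} (here l≤c c<a) =
  ∈-++⁺ˡ (∈-map⁺ (_∷ as) (∈-filter⁺ (l ≤?_) (∈-upTo⁺ c<a) l≤c))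
step-complete {l} {a ∷ as} (there s) =
  ∈-++⁺ʳ (List.map (_∷ as) (filter (l ≤?_) (upTo a))) (∈-map⁺ (a ∷_) (step-complete s))

step-decreases : ∀ {l as bs} → Step l as bs → sum bs < sum as
step-decreases {as = a ∷ as} (here _ c<a) = +-monoˡ-< (sum as) c<a
step-decreases {as = a ∷ as} (there s)    = +-monoʳ-< a (step-decreases s)

step-increasing : ∀ {l as bs} → Step l as bs → Increasing as → Increasing bs
step-increasing (here _ c<a)           [-]          = [-]
step-increasing (here _ c<a)           (a<b ∷ as↑)  = <-trans c<a a<b ∷ as↑
step-increasing (there s@(here a<c _)) (_ ∷ as↑)    = a<c ∷ step-increasing s as↑
step-increasing (there s@(there _))    (a<b ∷ as↑)  = a<b ∷ step-increasing s as↑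

silverDollar : Game
silverDollar = record
  { Position    = List ℕ
  ; _⟶_         = SDMove
  ; wellFounded = Subrelation.wellFounded step-decreases (On.wellFounded sum <-wellFounded)
  ; options     = stepOptions 0
  ; sound       = step-sound 0 _
  ; complete    = step-complete
  }

IsStarPosition : ∀ {m} → Vec (List ℕ) m → Set
IsStarPosition S =
  (∀ i → Increasing (lookup S i)) ×
  (∀ i j → 0 ∈ lookup S i → 0 ∈ lookup S j → i ≡ j)

isStarPosition? : ∀ {m} → Decidable (IsStarPosition {m})
isStarPosition? S =
  Fin.all? (λ i → linked? _<?_ (lookup S i)) ×-dec
  Fin.all? (λ i → Fin.all? (λ j →
    _∈?_ ℕ._≟_ 0 (lookup S i) →-dec (_∈?_ ℕ._≟_ 0 (lookup S j) →-dec (i Fin.≟ j))))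

data StarMove {m} (S : Vec (List ℕ) m) : Vec (List ℕ) m → Set where
  move : ∀ i {t} → SDMove (lookup S i) t → IsStarPosition (S [ i ]≔ t) →
         StarMove S (S [ i ]≔ t)

stripOptions : ∀ {m} → Vec (List ℕ) m → Fin m → List (Vec (List ℕ) m)
stripOptions S i = List.map (S [ i ]≔_) (stepOptions 0 (lookup S i))

starOptions : ∀ {m} → Vec (List ℕ) m → List (Vec (List ℕ) m)
starOptions {m} S = filter isStarPosition? (concatMap (stripOptions S) (allFin m))

star-sound : ∀ {m} (S : Vec (List ℕ) m) {S′} → S′ ∈ starOptions S → StarMove S S′
star-sound {m} S S′∈
  with S′∈′ , legal ← ∈-filter⁻ isStarPosition? {xs = concatMap (stripOptions S) (allFin m)} S′∈
  with i , _ , S′∈ᵢ ← find (∈-concatMap⁻ (stripOptions S) {xs = allFin m} S′∈′)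
  with t , t∈ , refl ← ∈-map⁻ (S [ i ]≔_) S′∈ᵢ =
  move i (step-sound 0 _ t∈) legal

star-complete : ∀ {m} {S S′ : Vec (List ℕ) m} → StarMove S S′ → S′ ∈ starOptions S
star-complete {S = S} (move i s legal) =
  ∈-filter⁺ isStarPosition?
    (∈-concatMap⁺ (stripOptions S)
      (lose (∈-allFin i) (∈-map⁺ (S [ i ]≔_) (step-complete s))))
    legal

total : ∀ {m} → Vec (List ℕ) m → ℕ
total S = Vec.sum (Vec.map sum S)

update-decreases : ∀ {m} (S : Vec (List ℕ) m) i {t} →
                   sum t < sum (lookup S i) → total (S [ i ]≔ t) < total S
update-decreases (s ∷ S) zero    t<s = +-monoˡ-< (total S) t<s
update-decreases (s ∷ S) (suc i) t<s = +-monoʳ-< (sum s) (update-decreases S i t<s)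

star-decreases : ∀ {m} {S S′ : Vec (List ℕ) m} → StarMove S S′ → total S′ < total S
star-decreases {S = S} (move i s _) = update-decreases S i (step-decreases s)

starSilverDollar : ℕ → Game
starSilverDollar m = record
  { Position    = Vec (List ℕ) m
  ; _⟶_         = StarMove
  ; wellFounded = Subrelation.wellFounded star-decreases (On.wellFounded total <-wellFounded)
  ; options     = starOptions
  ; sound       = star-sound _
  ; complete    = star-complete
  }

headSize : List ℕ → ℕ
headSize s with parity (length s)
... | 1ℙ = 1
... | 0ℙ = 2

headPart : List ℕ → List ℕ
headPart s = take (headSize s) s

tailPart : List ℕ → List ℕ
tailPart s = drop (headSize s) s

-- Expansions list the least significant digit first.
addDigits : Expansion 2 → Expansion 2 → Expansion 2
addDigits []       es       = es
addDigits (d ∷ ds) []       = d ∷ ds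
addDigits (d ∷ ds) (e ∷ es) = ((toℕ d + toℕ e) mod 2) ∷ addDigits ds es

infixl 6 _⊕_

_⊕_ : ℕ → ℕ → ℕ
m ⊕ n = fromDigits (addDigits (proj₁ (toDigits 2 m)) (proj₁ (toDigits 2 n)))

⨁ : ∀ {m} → Vec ℕ m → ℕ
⨁ = Vec.foldr′ _⊕_ 0

{-# OPTIONS --safe #-}

-- A token move in a strip is either a move of its head tokens or of its tail
-- tokens. The head moves are exactly the moves of the star game on the heads:
-- square 0 can only be occupied by a head token, so tails never affect
-- legality. Pairing the tail tokens from the left, the value of a tail is the
-- Nim-sum of the gaps b ∸ suc a of its pairs (a , b): every tail move changes
-- exactly one gap, and moving b shrinks its gap to any smaller value. Hence the
-- right-hand side of the theorem itself satisfies the mex recursion that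
-- determines the Sprague-Grundy value.

module Submission where

open import Defs
open import Data.Digit using (Digit; Expansion; toDigits; fromDigits)
open import Data.Empty using (⊥)
open import Data.Fin.Base using (zero; suc; toℕ)
import Data.Fin.Properties as Fin
open import Data.List.Base using (List; []; _∷_; length; take; drop)
open import Data.List.Membership.Propositional using (_∈_)
open import Data.List.Membership.Propositional.Properties using (∈-++⁺ˡ)
import Data.List.Properties as List
import Data.List.Relation.Unary.All as All
import Data.List.Relation.Unary.AllPairs.Properties as AllPairs
open import Data.List.Relation.Unary.AllPairs using (_∷_)
open import Data.List.Relation.Unary.Any using (here; there)
open import Data.List.Relation.Unary.Linked using ([]; _∷_; [-])
open import Data.List.Relation.Unary.Linked.Properties
  using (Linked⇒AllPairs; AllPairs⇒Linked)
open import Data.Nat.Base using (ℕ; zero; suc; _+_; _*_; _∸_; _≤_; _<_; s≤s; parity)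
open import Data.Nat.DivMod using (_mod_)
open import Data.Nat.Properties
open import Data.Parity.Base using (0ℙ; 1ℙ; _⁻¹)
open import Data.Parity.Properties using (suc-homo-⁻¹)
open import Data.Product.Base using (∃; _×_; _,_; proj₁; proj₂)
open import Data.Sum.Base as Sum using (_⊎_; inj₁; inj₂)
open import Data.Vec.Base using (Vec; []; _∷_; map; lookup; _[_]≔_)
import Data.Vec.Properties as Vec
open import Function.Base using (_∘_; flip)
open import Induction.WellFounded using (Acc; acc)
open import Relation.Binary.Definitions using (tri<; tri≈; tri>)
open import Relation.Binary.PropositionalEquality
open import Relation.Nullary using (¬_; contradiction)

-- Nim-sum

private
  ⟦_⟧ : Expansion 2 → ℕ
  ⟦_⟧ = fromDigits

-- A binary digit is at most 1 while the higher part enters with factor 2, so the lowest digits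
-- cannot reverse a strict comparison of the higher parts.
cons-mono-< : ∀ (d e : Digit 2) {m n} → m < n → toℕ d + m * 2 < toℕ e + n * 2
cons-mono-< d e {m} {n} m<n = begin-strict
  toℕ d + m * 2 <⟨ +-monoˡ-< (m * 2) (Fin.toℕ<n d) ⟩
  suc m * 2     ≤⟨ *-monoˡ-≤ 2 m<n ⟩
  n * 2         ≤⟨ m≤n+m (n * 2) (toℕ e) ⟩
  toℕ e + n * 2 ∎
  where open ≤-Reasoning

cons-cancel-< : ∀ (d e : Digit 2) m n → toℕ d + m * 2 < toℕ e + n * 2 →
                m < n ⊎ (m ≡ n × toℕ d < toℕ e)
cons-cancel-< d e m n p with <-cmp m n
... | tri< m<n _ _  = inj₁ m<n
... | tri≈ _ refl _ = inj₂ (refl , +-cancelʳ-< (m * 2) (toℕ d) (toℕ e) p)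
... | tri> _ _ n<m  = contradiction p (<-asym (cons-mono-< e d n<m))

cons-injective : ∀ (d e : Digit 2) m n → toℕ d + m * 2 ≡ toℕ e + n * 2 → d ≡ e × m ≡ n
cons-injective d e m n p with <-cmp m n
... | tri< m<n _ _  = contradiction p (<⇒≢ (cons-mono-< d e m<n))
... | tri≈ _ refl _ = Fin.toℕ-injective (+-cancelʳ-≡ (m * 2) (toℕ d) (toℕ e) p) , refl
... | tri> _ _ n<m  = contradiction (sym p) (<⇒≢ (cons-mono-< e d n<m))

-- Carry-free addition of digits and expansions

infixl 6 _+₂_

_+₂_ : Digit 2 → Digit 2 → Digit 2
d +₂ e = (toℕ d + toℕ e) mod 2

+₂-comm : ∀ d e → d +₂ e ≡ e +₂ d
+₂-comm d e = cong (_mod 2) (+-comm (toℕ d) (toℕ e))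

+₂-identityˡ : ∀ d → zero +₂ d ≡ d
+₂-identityˡ zero       = refl
+₂-identityˡ (suc zero) = refl

+₂-self : ∀ d → d +₂ d ≡ zero
+₂-self zero       = refl
+₂-self (suc zero) = refl

+₂-assoc : ∀ d e f → (d +₂ e) +₂ f ≡ d +₂ (e +₂ f)
+₂-assoc zero       e          f          = begin
  (zero +₂ e) +₂ f ≡⟨ cong (_+₂ f) (+₂-identityˡ e) ⟩
  e +₂ f           ≡⟨ +₂-identityˡ (e +₂ f) ⟨
  zero +₂ (e +₂ f) ∎
  where open ≡-Reasoning
+₂-assoc (suc zero) zero       zero       = refl
+₂-assoc (suc zero) zero       (suc zero) = refl
+₂-assoc (suc zero) (suc zero) zero       = refl
+₂-assoc (suc zero) (suc zero) (suc zero) = refl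

addDigits-identityʳ : ∀ ds → addDigits ds [] ≡ ds
addDigits-identityʳ []       = refl
addDigits-identityʳ (_ ∷ _) = refl

addDigits-comm : ∀ ds es → addDigits ds es ≡ addDigits es ds
addDigits-comm []       es       = sym (addDigits-identityʳ es)
addDigits-comm (d ∷ ds) []       = refl
addDigits-comm (d ∷ ds) (e ∷ es) = cong₂ _∷_ (+₂-comm d e) (addDigits-comm ds es)

addDigits-assoc : ∀ ds es fs → addDigits (addDigits ds es) fs ≡ addDigits ds (addDigits es fs)
addDigits-assoc []       es       fs       = refl
addDigits-assoc (d ∷ ds) []       fs       = refl
addDigits-assoc (d ∷ ds) (e ∷ es) []       = refl
addDigits-assoc (d ∷ ds) (e ∷ es) (f ∷ fs) =
  cong₂ _∷_ (+₂-assoc d e f) (addDigits-assoc ds es fs)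

addDigits-self : ∀ ds → ⟦ addDigits ds ds ⟧ ≡ 0
addDigits-self []       = refl
addDigits-self (d ∷ ds) rewrite +₂-self d | addDigits-self ds = refl

addDigits-zeroˡ : ∀ ds es → ⟦ ds ⟧ ≡ 0 → ⟦ addDigits ds es ⟧ ≡ ⟦ es ⟧
addDigits-zeroˡ []       es       p = refl
addDigits-zeroˡ (d ∷ ds) []       p = p
addDigits-zeroˡ (d ∷ ds) (e ∷ es) p with refl , q ← cons-injective d zero ⟦ ds ⟧ 0 p =
  cong₂ (λ x y → toℕ x + y * 2) (+₂-identityˡ e) (addDigits-zeroˡ ds es q)

addDigits-congˡ : ∀ ds ds′ es → ⟦ ds ⟧ ≡ ⟦ ds′ ⟧ → ⟦ addDigits ds es ⟧ ≡ ⟦ addDigits ds′ es ⟧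
addDigits-congˡ []       ds′        es       p = sym (addDigits-zeroˡ ds′ es (sym p))
addDigits-congˡ (d ∷ ds) []         es       p = addDigits-zeroˡ (d ∷ ds) es p
addDigits-congˡ (d ∷ ds) (d′ ∷ ds′) []       p = p
addDigits-congˡ (d ∷ ds) (d′ ∷ ds′) (e ∷ es) p
  with refl , q ← cons-injective d d′ ⟦ ds ⟧ ⟦ ds′ ⟧ p =
  cong (λ n → toℕ (d +₂ e) + n * 2) (addDigits-congˡ ds ds′ es q)

addDigits-cancelʳ : ∀ ds es → ⟦ addDigits (addDigits ds es) es ⟧ ≡ ⟦ ds ⟧
addDigits-cancelʳ ds es = begin
  ⟦ addDigits (addDigits ds es) es ⟧ ≡⟨ cong ⟦_⟧ (addDigits-assoc ds es es) ⟩
  ⟦ addDigits ds (addDigits es es) ⟧ ≡⟨ cong ⟦_⟧ (addDigits-comm ds (addDigits es es)) ⟩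
  ⟦ addDigits (addDigits es es) ds ⟧ ≡⟨ addDigits-zeroˡ (addDigits es es) ds (addDigits-self es) ⟩
  ⟦ ds ⟧                             ∎
  where open ≡-Reasoning

-- For a target `ks`, one of the Nim heaps `ds` and `es` can be lowered to reach it: the new heap is
-- the target plus the other heap.
SomeSmaller : Expansion 2 → Expansion 2 → Expansion 2 → Set
SomeSmaller ks ds es = ⟦ addDigits ks es ⟧ < ⟦ ds ⟧ ⊎ ⟦ addDigits ks ds ⟧ < ⟦ es ⟧

-- The higher digits of the target and of the sum decide unless they agree. If they agree, `k` is 0
-- and exactly one of `d` and `e` is 1; that heap keeps its higher part and its lowest digit drops
-- to 0. The recursive result is a parameter so that an empty `ks` can use the lemma too.
someSmaller-∷ : ∀ k ks d ds e es →
  (⟦ ks ⟧ < ⟦ addDigits ds es ⟧ → SomeSmaller ks ds es) →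
  ⟦ k ∷ ks ⟧ < ⟦ addDigits (d ∷ ds) (e ∷ es) ⟧ → SomeSmaller (k ∷ ks) (d ∷ ds) (e ∷ es)
someSmaller-∷ k ks d ds e es rec p
  with cons-cancel-< k (d +₂ e) ⟦ ks ⟧ ⟦ addDigits ds es ⟧ p
... | inj₁ ks< = Sum.map (cons-mono-< (k +₂ e) d) (cons-mono-< (k +₂ d) e) (rec ks<)
... | inj₂ (ks≡ , k<) = leading k d e k<
  where
  ks+es≡ds : ⟦ addDigits ks es ⟧ ≡ ⟦ ds ⟧
  ks+es≡ds = trans (addDigits-congˡ ks (addDigits ds es) es ks≡) (addDigits-cancelʳ ds es)

  ks+ds≡es : ⟦ addDigits ks ds ⟧ ≡ ⟦ es ⟧
  ks+ds≡es = trans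
    (addDigits-congˡ ks (addDigits es ds) ds (trans ks≡ (cong ⟦_⟧ (addDigits-comm ds es))))
    (addDigits-cancelʳ es ds)

  leading : ∀ k d e → toℕ k < toℕ (d +₂ e) → SomeSmaller (k ∷ ks) (d ∷ ds) (e ∷ es)
  leading zero       zero       (suc zero) _ = inj₂ (s≤s (≤-reflexive (cong (_* 2) ks+ds≡es)))
  leading zero       (suc zero) zero       _ = inj₁ (s≤s (≤-reflexive (cong (_* 2) ks+es≡ds)))
  leading (suc zero) zero       (suc zero) (s≤s ())
  leading (suc zero) (suc zero) zero       (s≤s ())
  leading zero       (suc zero) (suc zero) ()
  leading (suc zero) (suc zero) (suc zero) ()

someSmaller : ∀ ks ds es → ⟦ ks ⟧ < ⟦ addDigits ds es ⟧ → SomeSmaller ks ds es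
someSmaller ks       []       es       p rewrite addDigits-identityʳ ks = inj₂ p
someSmaller ks       (d ∷ ds) []       p rewrite addDigits-identityʳ ks = inj₁ p
someSmaller (k ∷ ks) (d ∷ ds) (e ∷ es) p = someSmaller-∷ k ks d ds e es (someSmaller ks ds es) p
-- The empty expansion is padded to the single digit 0, which has the same value; the two identities
-- remove the padding again.
someSmaller []       (d ∷ ds) (e ∷ es) p
  with someSmaller-∷ zero [] d ds e es (someSmaller [] ds es) p
... | q rewrite +₂-identityˡ d | +₂-identityˡ e = q

-- Transfer from expansions to numbers

digits : ℕ → Expansion 2
digits n = proj₁ (toDigits 2 n)

⟦digits⟧ : ∀ n → ⟦ digits n ⟧ ≡ n
⟦digits⟧ n = proj₂ (toDigits 2 n)

⊕-comm : ∀ m n → m ⊕ n ≡ n ⊕ m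
⊕-comm m n = cong ⟦_⟧ (addDigits-comm (digits m) (digits n))

⊕-fromDigitsˡ : ∀ ds n → ⟦ ds ⟧ ⊕ n ≡ ⟦ addDigits ds (digits n) ⟧
⊕-fromDigitsˡ ds n = addDigits-congˡ (digits ⟦ ds ⟧) ds (digits n) (⟦digits⟧ ⟦ ds ⟧)

⊕-fromDigitsʳ : ∀ m es → m ⊕ ⟦ es ⟧ ≡ ⟦ addDigits (digits m) es ⟧
⊕-fromDigitsʳ m es = begin
  m ⊕ ⟦ es ⟧                  ≡⟨ ⊕-comm m ⟦ es ⟧ ⟩
  ⟦ es ⟧ ⊕ m                  ≡⟨ ⊕-fromDigitsˡ es m ⟩
  ⟦ addDigits es (digits m) ⟧ ≡⟨ cong ⟦_⟧ (addDigits-comm es (digits m)) ⟩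
  ⟦ addDigits (digits m) es ⟧ ∎
  where open ≡-Reasoning

⊕-assoc : ∀ m n o → (m ⊕ n) ⊕ o ≡ m ⊕ (n ⊕ o)
⊕-assoc m n o = begin
  (m ⊕ n) ⊕ o
    ≡⟨ ⊕-fromDigitsˡ (addDigits (digits m) (digits n)) o ⟩
  ⟦ addDigits (addDigits (digits m) (digits n)) (digits o) ⟧
    ≡⟨ cong ⟦_⟧ (addDigits-assoc (digits m) (digits n) (digits o)) ⟩
  ⟦ addDigits (digits m) (addDigits (digits n) (digits o)) ⟧
    ≡⟨ ⊕-fromDigitsʳ m (addDigits (digits n) (digits o)) ⟨
  m ⊕ (n ⊕ o) ∎
  where open ≡-Reasoning

⊕-involutiveʳ : ∀ m n → (m ⊕ n) ⊕ n ≡ m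
⊕-involutiveʳ m n = begin
  (m ⊕ n) ⊕ n
    ≡⟨ ⊕-fromDigitsˡ (addDigits (digits m) (digits n)) n ⟩
  ⟦ addDigits (addDigits (digits m) (digits n)) (digits n) ⟧
    ≡⟨ addDigits-cancelʳ (digits m) (digits n) ⟩
  ⟦ digits m ⟧
    ≡⟨ ⟦digits⟧ m ⟩
  m ∎
  where open ≡-Reasoning

⊕-cancelʳ : ∀ {m n} o → m ⊕ o ≡ n ⊕ o → m ≡ n
⊕-cancelʳ {m} {n} o p = begin
  m           ≡⟨ ⊕-involutiveʳ m o ⟨
  (m ⊕ o) ⊕ o ≡⟨ cong (_⊕ o) p ⟩
  (n ⊕ o) ⊕ o ≡⟨ ⊕-involutiveʳ n o ⟩
  n           ∎
  where open ≡-Reasoning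

⊕-cancelˡ : ∀ m {n o} → m ⊕ n ≡ m ⊕ o → n ≡ o
⊕-cancelˡ m {n} {o} p = ⊕-cancelʳ m (trans (⊕-comm n m) (trans p (⊕-comm m o)))

⊕-option : ∀ {k} m n → k < m ⊕ n →
           (∃ λ m′ → m′ < m × m′ ⊕ n ≡ k) ⊎ (∃ λ n′ → n′ < n × m ⊕ n′ ≡ k)
⊕-option {k} m n k<
  with someSmaller (digits k) (digits m) (digits n) (subst (_< m ⊕ n) (sym (⟦digits⟧ k)) k<)
-- By cancellation `k ⊕ n` is the only candidate for the lowered first heap; `p` says that it is
-- below `m`.
... | inj₁ p = inj₁ (k ⊕ n , subst (k ⊕ n <_) (⟦digits⟧ m) p , ⊕-involutiveʳ k n)
... | inj₂ p = inj₂ (k ⊕ m , subst (k ⊕ m <_) (⟦digits⟧ n) p ,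
                     trans (⊕-comm m (k ⊕ m)) (⊕-involutiveʳ k m))

⨁-update-injective : ∀ {m} (v : Vec ℕ m) i {x} → ⨁ (v [ i ]≔ x) ≡ ⨁ v → x ≡ lookup v i
⨁-update-injective (y ∷ v) zero    p = ⊕-cancelʳ (⨁ v) p
⨁-update-injective (y ∷ v) (suc i) p = ⨁-update-injective v i (⊕-cancelˡ y p)

⨁-option : ∀ {m k} (v : Vec ℕ m) → k < ⨁ v →
           ∃ λ i → ∃ λ x → x < lookup v i × ⨁ (v [ i ]≔ x) ≡ k
⨁-option (y ∷ v) k< with ⊕-option y (⨁ v) k<
... | inj₁ (y′ , y′<y , eq) = zero , y′ , y′<y , eq
... | inj₂ (r , r< , eq) =
  let i , x , x< , eq′ = ⨁-option v r<
  in suc i , x , x< , trans (cong (y ⊕_) eq′) eq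

-- Sprague-Grundy values

isMex-unique : ∀ {P : ℕ → Set} {m n} → IsMex P m → IsMex P n → m ≡ n
isMex-unique {m = m} {n} (¬Pm , below-m) (¬Pn , below-n) with <-cmp m n
... | tri< m<n _ _ = contradiction (below-n m<n) ¬Pm
... | tri≈ _ m≡n _ = m≡n
... | tri> _ _ n<m = contradiction (below-m n<m) ¬Pn

module _ (G : Game) where
  open Game G

  -- By well-founded induction the options of `p` have their `f`-values as Sprague-Grundy values;
  -- `changes` and `reaches` then make `f p` their mex. Moves that raise `f` are allowed. The
  -- invariant `P` confines the argument to legal positions.
  𝒢-unique : (P : Position → Set) (f : Position → ℕ) →
             (∀ {p q} → P p → p ⟶ q → P q) →
             (∀ {p q} → P p → p ⟶ q → f q ≢ f p) →
             (∀ {p k} → P p → k < f p → ∃ λ q → p ⟶ q × f q ≡ k) →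
             ∀ {p} → P p → 𝒢 G p ≡ f p
  𝒢-unique P f closed changes reaches {p} = go p (wellFounded p)
    where
    go : ∀ p → Acc (flip _⟶_) p → P p → 𝒢 G p ≡ f p
    go p (acc rs) Pp = isMex-unique (𝒢-isMex G p) (absent , present)
      where
      absent : ¬ (∃ λ q → p ⟶ q × 𝒢 G q ≡ f p)
      absent (q , p⟶q , eq) =
        changes Pp p⟶q (trans (sym (go q (rs p⟶q) (closed Pp p⟶q))) eq)

      present : ∀ {k} → k < f p → ∃ λ q → p ⟶ q × 𝒢 G q ≡ k
      present k< with q , p⟶q , eq ← reaches Pp k< =
        q , p⟶q , trans (go q (rs p⟶q) (closed Pp p⟶q)) eq

-- Strips with evenly many tokens

EvenLength : List ℕ → Set
EvenLength as = parity (length as) ≡ 0ℙ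

step-length : ∀ {l as bs} → Step l as bs → length bs ≡ length as
step-length (here _ _) = refl
step-length (there s)  = cong suc (step-length s)

-- On an increasing list `b ∸ suc a` counts the empty squares between the tokens of a pair. The
-- default 0 ignores a lone last token, whose moves would leave the sum unchanged; hence the
-- assumption of even length in `gaps-changes`.
gaps : List ℕ → ℕ
gaps (a ∷ b ∷ as) = (b ∸ suc a) ⊕ gaps as
gaps _            = 0

increasing-tail : ∀ {a as} → Increasing (a ∷ as) → Increasing as
increasing-tail [-]       = []
increasing-tail (_ ∷ as↑) = as↑

-- Moving the left token of a pair widens its gap and moving the right token narrows it; `a<b` and
-- `a<c` keep the subtractions from truncating. The other gaps cancel.
gaps-changes : ∀ {l as bs} → EvenLength as → Increasing as → Step l as bs → gaps bs ≢ gaps as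
gaps-changes {as = a ∷ b ∷ as} _ (a<b ∷ _) (here {c = c} _ c<a) eq =
  <⇒≢ (∸-monoʳ-< (s≤s c<a) a<b) (sym (⊕-cancelʳ (gaps as) eq))
gaps-changes {as = a ∷ b ∷ as} _ _ (there (here a<c c<b)) eq =
  <⇒≢ (∸-monoˡ-< c<b a<c) (⊕-cancelʳ (gaps as) eq)
gaps-changes {as = a ∷ b ∷ as} even as↑ (there (there s)) eq =
  gaps-changes even (increasing-tail (increasing-tail as↑)) s (⊕-cancelˡ (b ∸ suc a) eq)

m<n∸o⇒o+m<n : ∀ {m n} o → m < n ∸ o → o + m < n
m<n∸o⇒o+m<n         zero    m<n∸o = m<n∸o
m<n∸o⇒o+m<n {n = suc n} (suc o) m<n∸o = s≤s (m<n∸o⇒o+m<n o m<n∸o)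

-- Only right tokens of pairs are moved, so the move exists for every bound l.
gaps-reaches : ∀ {k} as → k < gaps as → ∃ λ bs → (∀ l → Step l as bs) × gaps bs ≡ k
gaps-reaches (a ∷ b ∷ as) k< with ⊕-option (b ∸ suc a) (gaps as) k<
... | inj₁ (g , g< , eq) =
  -- The right token lands where exactly `g` empty squares separate it from `a`.
  a ∷ suc a + g ∷ as ,
  (λ l → there (here (m≤m+n (suc a) g) (m<n∸o⇒o+m<n (suc a) g<))) ,
  trans (cong (_⊕ gaps as) (m+n∸m≡n (suc a) g)) eq
... | inj₂ (r , r< , eq) with bs , s , eq′ ← gaps-reaches as r< =
  a ∷ b ∷ bs , (λ l → there (there (s (suc b)))) , trans (cong ((b ∸ suc a) ⊕_) eq′) eq

𝒢-even : ∀ {as} → EvenLength as → Increasing as → 𝒢 silverDollar as ≡ gaps as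
𝒢-even even as↑ =
  𝒢-unique silverDollar (λ as → EvenLength as × Increasing as) gaps
    (λ (even , as↑) s → trans (cong parity (step-length s)) even , step-increasing s as↑)
    (λ (even , as↑) → gaps-changes even as↑)
    (λ {as} _ k< → let bs , s , eq = gaps-reaches as k< in bs , s 0 , eq)
    (even , as↑)

-- Heads and tails

-- The bound `l′` in force at the tail comes from the last head token. It is left existential
-- because `gaps-changes` accepts any bound.
step-split : ∀ n {l as bs} → Step l as bs →
  (Step l (take n as) (take n bs) × drop n bs ≡ drop n as) ⊎
  (take n bs ≡ take n as × ∃ λ l′ → Step l′ (drop n as) (drop n bs))
step-split zero    s              = inj₂ (refl , _ , s)
step-split (suc n) (here l≤c c<a) = inj₁ (here l≤c c<a , refl)
step-split (suc n) (there {a} s)  =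
  Sum.map (λ (s′ , eq) → there s′ , eq) (λ (eq , s′) → cong (a ∷_) eq , s′) (step-split n s)

-- Tokens only move left and are blocked only by tokens to their left, so restoring the tail cannot
-- obstruct a head move.
step-take⁻ : ∀ n {l as hs} → Step l (take n as) hs →
  ∃ λ bs → Step l as bs × take n bs ≡ hs × drop n bs ≡ drop n as
step-take⁻ (suc n) {as = a ∷ as} (here l≤c c<a) = _ , here l≤c c<a , refl , refl
step-take⁻ (suc n) {as = a ∷ as} (there s) with bs , s′ , eq₁ , eq₂ ← step-take⁻ n s =
  a ∷ bs , there s′ , cong (a ∷_) eq₁ , eq₂

-- The tail alone does not determine the bound set by the last head token, so the move is required
-- for every bound, as `gaps-reaches` provides it.
step-drop⁻ : ∀ n {l as ts} → (∀ l′ → Step l′ (drop n as) ts) →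
  ∃ λ bs → Step l as bs × take n bs ≡ take n as × drop n bs ≡ ts
step-drop⁻ zero    {l}            s = _ , s l , refl , refl
step-drop⁻ (suc n) {l} {[]}       s with () ← s l
step-drop⁻ (suc n) {l} {a ∷ as}   s with bs , s′ , eq₁ , eq₂ ← step-drop⁻ n s =
  a ∷ bs , there s′ , cong (a ∷_) eq₁ , eq₂

headSize-length : ∀ {as bs} → length bs ≡ length as → headSize bs ≡ headSize as
headSize-length {as} {bs} eq rewrite eq = refl

-- A move keeps the number of tokens, so both strips are cut at the same place.
headPart-step : ∀ {l as bs} → Step l as bs → headPart bs ≡ take (headSize as) bs
headPart-step {as = as} {bs} s = cong (λ n → take n bs) (headSize-length {as} {bs} (step-length s))

tailPart-step : ∀ {l as bs} → Step l as bs → tailPart bs ≡ drop (headSize as) bs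
tailPart-step {as = as} {bs} s = cong (λ n → drop n bs) (headSize-length {as} {bs} (step-length s))

part-split : ∀ {l as bs} → Step l as bs →
  (Step l (headPart as) (headPart bs) × tailPart bs ≡ tailPart as) ⊎
  (headPart bs ≡ headPart as × ∃ λ l′ → Step l′ (tailPart as) (tailPart bs))
part-split {as = as} s rewrite headPart-step s | tailPart-step s = step-split (headSize as) s

step-headPart⁻ : ∀ {l as hs} → Step l (headPart as) hs →
  ∃ λ bs → Step l as bs × headPart bs ≡ hs × tailPart bs ≡ tailPart as
step-headPart⁻ {as = as} s with bs , s′ , eq₁ , eq₂ ← step-take⁻ (headSize as) s =
  bs , s′ , trans (headPart-step s′) eq₁ , trans (tailPart-step s′) eq₂

step-tailPart⁻ : ∀ {l as ts} → (∀ l′ → Step l′ (tailPart as) ts) →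
  ∃ λ bs → Step l as bs × headPart bs ≡ headPart as × tailPart bs ≡ ts
step-tailPart⁻ {as = as} s with bs , s′ , eq₁ , eq₂ ← step-drop⁻ (headSize as) s =
  bs , s′ , trans (headPart-step s′) eq₁ , trans (tailPart-step s′) eq₂

-- The head size is chosen for this: dropping one token from an odd strip or two from an even one
-- leaves a tail that can be paired completely.
tailPart-even : ∀ as → EvenLength (tailPart as)
tailPart-even as with parity (length as) in eq
tailPart-even (a ∷ as)     | 1ℙ = trans (sym (suc-homo-⁻¹ (length as))) (cong _⁻¹ eq)
tailPart-even []           | 0ℙ = refl
tailPart-even (a ∷ b ∷ as) | 0ℙ = eq

headPart-increasing : ∀ as → Increasing as → Increasing (headPart as)
headPart-increasing as as↑ =
  AllPairs⇒Linked (AllPairs.take⁺ (headSize as) (Linked⇒AllPairs <-trans as↑))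

tailPart-increasing : ∀ as → Increasing as → Increasing (tailPart as)
tailPart-increasing as as↑ =
  AllPairs⇒Linked (AllPairs.drop⁺ (headSize as) (Linked⇒AllPairs <-trans as↑))

∈-take⁻ : ∀ n {x : ℕ} as → x ∈ take n as → x ∈ as
∈-take⁻ n as x∈ = subst (_ ∈_) (List.take++drop≡id n as) (∈-++⁺ˡ x∈)

-- In an increasing list every entry after the first exceeds the first, so 0 can only come first.
0∈-take⁺ : ∀ n {as} → Increasing as → 0 ∈ as → 0 ∈ take (suc n) as
0∈-take⁺ n as↑ (here eq)  = here eq
0∈-take⁺ n as↑ (there 0∈) with a< ∷ _ ← Linked⇒AllPairs <-trans as↑ =
  contradiction (All.lookup a< 0∈) (λ ())

0∈-headPart⁺ : ∀ {as} → Increasing as → 0 ∈ as → 0 ∈ headPart as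
0∈-headPart⁺ {as} as↑ 0∈ with parity (length as)
... | 1ℙ = 0∈-take⁺ 0 as↑ 0∈
... | 0ℙ = 0∈-take⁺ 1 as↑ 0∈

-- Star positions

module _ {A : Set} where
  lookup-update-P : ∀ {m} (P : A → Set) (v : Vec A m) i {x} →
                    (∀ j → P (lookup v j)) → P x → ∀ j → P (lookup (v [ i ]≔ x) j)
  lookup-update-P P (y ∷ v) zero    Pv Px zero    = Px
  lookup-update-P P (y ∷ v) zero    Pv Px (suc j) = Pv (suc j)
  lookup-update-P P (y ∷ v) (suc i) Pv Px zero    = Pv zero
  lookup-update-P P (y ∷ v) (suc i) Pv Px (suc j) = lookup-update-P P v i (Pv ∘ suc) Px j

  map-update-id : ∀ {B : Set} {m} (f : A → B) (v : Vec A m) i {x} →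
                  f x ≡ f (lookup v i) → map f (v [ i ]≔ x) ≡ map f v
  map-update-id f v i {x} eq = begin
    map f (v [ i ]≔ x)                ≡⟨ Vec.map-[]≔ f v i ⟩
    map f v [ i ]≔ f x                ≡⟨ cong (map f v [ i ]≔_) eq ⟩
    map f v [ i ]≔ f (lookup v i)     ≡⟨ cong (map f v [ i ]≔_) (Vec.lookup-map i f v) ⟨
    map f v [ i ]≔ lookup (map f v) i ≡⟨ Vec.[]≔-lookup (map f v) i ⟩
    map f v                           ∎
    where open ≡-Reasoning

module _ {m} (S : Vec (List ℕ) m) where
  heads-starPosition⁺ : IsStarPosition S → IsStarPosition (map headPart S)
  heads-starPosition⁺ (S↑ , unique) =
    (λ i → subst Increasing (sym (Vec.lookup-map i headPart S)) (headPart-increasing (lookup S i) (S↑ i))) ,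
    (λ i j 0∈i 0∈j → unique i j (lift i 0∈i) (lift j 0∈j))
    where
    lift : ∀ i → 0 ∈ lookup (map headPart S) i → 0 ∈ lookup S i
    lift i = ∈-take⁻ (headSize (lookup S i)) (lookup S i) ∘ subst (0 ∈_) (Vec.lookup-map i headPart S)

  heads-starPosition⁻ : (∀ i → Increasing (lookup S i)) →
                        IsStarPosition (map headPart S) → IsStarPosition S
  heads-starPosition⁻ S↑ (_ , unique) =
    S↑ , λ i j 0∈i 0∈j → unique i j (restrict i 0∈i) (restrict j 0∈j)
    where
    restrict : ∀ i → 0 ∈ lookup S i → 0 ∈ lookup (map headPart S) i
    restrict i = subst (0 ∈_) (sym (Vec.lookup-map i headPart S)) ∘ 0∈-headPart⁺ (S↑ i)

starMove-legal : ∀ {m} {S S′ : Vec (List ℕ) m} → StarMove S S′ → IsStarPosition S′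
starMove-legal (move _ _ legal) = legal

-- The step itself keeps the strips increasing, so only the shared square remains to be checked, and
-- the heads decide that.
starMove : ∀ {m} (S : Vec (List ℕ) m) → IsStarPosition S → ∀ i {bs} → SDMove (lookup S i) bs →
           IsStarPosition (map headPart (S [ i ]≔ bs)) → StarMove S (S [ i ]≔ bs)
starMove S legal i {bs} s legal′ = move i s (heads-starPosition⁻ (S [ i ]≔ bs)
  (lookup-update-P Increasing S i (proj₁ legal) (step-increasing s (proj₁ legal i))) legal′)

-- The value function and its mex recursion

heads : ∀ {m} → Vec (List ℕ) m → Vec (List ℕ) m
heads = map headPart

tailGaps : List ℕ → ℕ
tailGaps as = gaps (tailPart as)

heads-starMove : ∀ {m} (S : Vec (List ℕ) m) i {bs} →
  SDMove (headPart (lookup S i)) (headPart bs) → IsStarPosition (S [ i ]≔ bs) →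
  StarMove (heads S) (heads (S [ i ]≔ bs))
heads-starMove S i {bs} s legal = subst (StarMove (heads S)) (sym eq)
  (move i (subst (λ as → SDMove as (headPart bs)) (sym (Vec.lookup-map i headPart S)) s)
    (subst IsStarPosition eq (heads-starPosition⁺ (S [ i ]≔ bs) legal)))
  where
  eq : heads (S [ i ]≔ bs) ≡ heads S [ i ]≔ headPart bs
  eq = Vec.map-[]≔ headPart S i

-- The values of the star game enter only through the mex property; keeping them
-- abstract stops the type checker from evaluating them.
module _ {m} (g : Vec (List ℕ) m → ℕ)
         (g-isMex : ∀ H → IsMex (λ v → ∃ λ H′ → StarMove H H′ × g H′ ≡ v) (g H)) where

  -- With `g` the Sprague-Grundy function of the star game, this is the right-hand side of the
  -- theorem, the values of the tails being expressed by gaps.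
  value : Vec (List ℕ) m → ℕ
  value S = g (heads S) ⊕ ⨁ (map tailGaps S)

  -- A head move changes the `g` summand by the mex property, and a tail move changes the gaps of
  -- one tail. The untouched summands cancel, so the whole sum changes in either case.
  value-changes : ∀ {S S′} → IsStarPosition S → StarMove S S′ → value S′ ≢ value S
  value-changes {S} (S↑ , _) (move i {bs} s legal) eq = cases (part-split s)
    where
    S′ : Vec (List ℕ) m
    S′ = S [ i ]≔ bs

    cases : (SDMove (headPart (lookup S i)) (headPart bs) × tailPart bs ≡ tailPart (lookup S i)) ⊎
            (headPart bs ≡ headPart (lookup S i) ×
             ∃ λ l → Step l (tailPart (lookup S i)) (tailPart bs)) → ⊥
    cases (inj₁ (s , tail-eq)) =
      proj₁ (g-isMex (heads S)) (heads S′ , heads-starMove S i s legal ,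
        ⊕-cancelʳ {g (heads S′)} {g (heads S)} (⨁ (map tailGaps S))
          (trans (cong (λ v → g (heads S′) ⊕ ⨁ v)
                   (sym (map-update-id tailGaps S i (cong gaps tail-eq))))
                 eq))
    cases (inj₂ (head-eq , _ , s)) =
      gaps-changes {as = tailPart (lookup S i)} {tailPart bs}
        (tailPart-even (lookup S i)) (tailPart-increasing (lookup S i) (S↑ i)) s
        (trans (⨁-update-injective (map tailGaps S) i tails-eq) (Vec.lookup-map i tailGaps S))
      where
      tails-eq : ⨁ (map tailGaps S [ i ]≔ tailGaps bs) ≡ ⨁ (map tailGaps S)
      tails-eq = ⊕-cancelˡ (g (heads S)) {⨁ (map tailGaps S [ i ]≔ tailGaps bs)} {⨁ (map tailGaps S)}
        (trans (sym (cong₂ (λ H v → g H ⊕ ⨁ v)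
                 (map-update-id headPart S i head-eq) (Vec.map-[]≔ tailGaps S i)))
               eq)

  -- As in Nim, a smaller value is reached by lowering one summand. For the heads the mex property
  -- supplies a star move, which lifts to the full strips; for a tail a gap is narrowed.
  value-reaches : ∀ {S k} → IsStarPosition S → k < value S →
                  ∃ λ S′ → StarMove S S′ × value S′ ≡ k
  value-reaches {S} {k} legal k< = cases (⊕-option (g (heads S)) (⨁ (map tailGaps S)) k<)
    where
    Result : Set
    Result = ∃ λ S′ → StarMove S S′ × value S′ ≡ k

    head-move : ∀ {H} → StarMove (heads S) H → g H ⊕ ⨁ (map tailGaps S) ≡ k → Result
    head-move (move i {hs} s legal′) eq =
      let bs , s′ , head-eq , tail-eq =
            step-headPart⁻ (subst (λ as → SDMove as hs) (Vec.lookup-map i headPart S) s)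
          heads-eq = trans (Vec.map-[]≔ headPart S i) (cong (heads S [ i ]≔_) head-eq)
          tails-eq = map-update-id tailGaps S i (cong gaps tail-eq)
      in S [ i ]≔ bs ,
         starMove S legal i s′ (subst IsStarPosition (sym heads-eq) legal′) ,
         trans (cong₂ (λ H v → g H ⊕ ⨁ v) heads-eq tails-eq) eq

    tail-move : ∀ i {x} → x < lookup (map tailGaps S) i →
                g (heads S) ⊕ ⨁ (map tailGaps S [ i ]≔ x) ≡ k → Result
    tail-move i {x} x< eq =
      let ts , s , gaps≡x = gaps-reaches (tailPart (lookup S i))
                              (subst (x <_) (Vec.lookup-map i tailGaps S) x<)
          bs , s′ , head-eq , tail-eq = step-tailPart⁻ {as = lookup S i} s
          heads-eq = map-update-id headPart S i head-eq
          tails-eq = trans (Vec.map-[]≔ tailGaps S i)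
                       (cong (map tailGaps S [ i ]≔_) (trans (cong gaps tail-eq) gaps≡x))
      in S [ i ]≔ bs ,
         -- The heads are unchanged, so legality is inherited from `S`.
         starMove S legal i s′ (subst IsStarPosition (sym heads-eq) (heads-starPosition⁺ S legal)) ,
         trans (cong₂ (λ H v → g H ⊕ ⨁ v) heads-eq tails-eq) eq

    cases : (∃ λ h → h < g (heads S) × h ⊕ ⨁ (map tailGaps S) ≡ k) ⊎
            (∃ λ r → r < ⨁ (map tailGaps S) × g (heads S) ⊕ r ≡ k) → Result
    cases (inj₁ (h , h< , eq)) =
      let H , H-move , gH≡h = proj₂ (g-isMex (heads S)) h<
      in head-move H-move (trans (cong (_⊕ ⨁ (map tailGaps S)) gH≡h) eq)
    cases (inj₂ (r , r< , eq)) =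
      let i , x , x< , sum≡r = ⨁-option (map tailGaps S) r<
      in tail-move i x< (trans (cong (g (heads S) ⊕_) sum≡r) eq)

  value-unique : ∀ {S} → IsStarPosition S → 𝒢 (starSilverDollar m) S ≡ value S
  value-unique = 𝒢-unique (starSilverDollar m) IsStarPosition value
    (λ _ → starMove-legal) value-changes value-reaches

map-cong-lookup : ∀ {A B : Set} {m} {f g : A → B} (v : Vec A m) →
                  (∀ i → f (lookup v i) ≡ g (lookup v i)) → map f v ≡ map g v
map-cong-lookup []      eq = refl
map-cong-lookup (x ∷ v) eq = cong₂ _∷_ (eq zero) (map-cong-lookup v (eq ∘ suc))

theorem2 : ∀ (m : ℕ) → 1 ≤ m →
    (S : Vec (List ℕ) m) → IsStarPosition S →
    (∀ i → 1 ≤ length (lookup S i)) →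
    𝒢 (starSilverDollar m) S ≡
    𝒢 (starSilverDollar m) (map headPart S) ⊕ ⨁ (map (λ s → 𝒢 silverDollar (tailPart s)) S)
theorem2 m _ S legal _ =
  trans (value-unique (𝒢 (starSilverDollar m)) (𝒢-isMex (starSilverDollar m)) legal)
    -- It remains to turn the gaps of each tail back into its Sprague-Grundy value, as its even
    -- length permits.
    (cong (λ v → 𝒢 (starSilverDollar m) (heads S) ⊕ ⨁ v)
      (map-cong-lookup S λ i →
        sym (𝒢-even {tailPart (lookup S i)} (tailPart-even (lookup S i))
          (tailPart-increasing (lookup S i) (proj₁ legal i)))))
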